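{- Let $m,n\ge 1$ be integers, let $p_1,\dots,p_k$ be distinct primes including all primes dividing $mn$, and write $m=\prod_{i=1}^k p_i^{a_i}$, $n=\prod_{i=1}^k p_i^{b_i}$ with $a_i,b_i\ge 0$. Put $\delta_i=|b_i-a_i|$, $\delta=(\delta_1,\dots,\delta_k)$, $\sigma_i=\operatorname{sgn}(b_i-a_i)$, and for integer vectors $r=(r_1,\dots,r_k)$ with $0\le r_i\le\delta_i$ put $$N(r)=\prod_{i=1}^k p_i^{a_i+\sigma_i r_i},\qquad D(r)=\prod_{i=1}^k (a_i+\sigma_i r_i+1).$$ Fix $X\ge\max\{m,n\}$ and call a state $r$ admissible if $N(r)\le X$. Define $F$ on the states as follows: $F(r)=0$ for every inadmissible $r$; $F(0)=D(0)$; and for admissible $r\neq 0$, $$F(r)=\min\Bigl\{D(r),\ \max_{\substack{i:\ r_i>0\\ N(r-e_i)\le X}}F(r-e_i)\Bigr\},$$ where $e_i$ is the $i$-th standard unit vector and $\max\varnothing:=0$. Then $$F(\delta)=\mathcal G_X(m,n).$$ Moreover, the number of states (before excluding inadmissible ones) is $\prod_{i=1}^k(\delta_i+1)$.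
   Context: $d(n)$ denotes the number of positive divisors of $n$. A (directed exponent-lattice) geodesic from $m$ to $n$ is a finite sequence of positive integers starting at $m$ and ending at $n$ in which each step changes the exponent of exactly one prime by one unit, always in the direction of its target exponent (equivalently, it has the minimum length $\sum_i|b_i-a_i|$). For $X\ge\max\{m,n\}$, a geodesic is $X$-admissible if all its vertices $z$ satisfy $z\le X$. The optimal geodesic bottleneck is $$\mathcal G_X(m,n)=\max_{\gamma}\ \min_{z\in\gamma}d(z),$$ where $\gamma$ ranges over the $X$-admissible geodesics from $m$ to $n$ and $z\in\gamma$ ranges over all vertices, endpoints included. -}

module Defs where

open import Data.Fin.Base using (Fin; zero; suc)
import Data.Fin.Properties as Fin
open import Data.Integer.Base as ℤ using (ℤ; +_; +0; +[1+_]; -[1+_]; 0ℤ; 1ℤ; -1ℤ)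
import Data.Integer.Properties as ℤ
open import Data.List.Base as List using (allFin; applyUpTo; filter; length; upTo)
open import Data.List.Extrema.Nat using (max; v≤max⁺; argmax-all)
open import Data.List.Membership.Propositional using (lose)
open import Data.List.Membership.Propositional.Properties using (∈-filter⁺; ∈-upTo⁺)
open import Data.List.NonEmpty.Base as List⁺ using (List⁺; [_]; _∷⁺_; foldr₁)
open import Data.List.NonEmpty.Relation.Unary.All using (All)
open import Data.List.Properties using (map-cong-local)
import Data.List.Relation.Unary.All as LAll
open import Data.List.Relation.Unary.All.Properties using (all-filter)
open import Data.Nat.Base
open import Data.Nat.Divisibility using (_∣_; _∣?_; ∣⇒≤; 1∣_)
open import Data.Nat.Primality using (Prime)
open import Data.Nat.Properties
open import Data.Product.Base using (∃-syntax; _×_; _,_; proj₁)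
open import Data.Sum.Base using (_⊎_; inj₁; inj₂)
open import Data.Vec.Base using (Vec; _∷_; lookup; replicate; sum; tabulate; updateAt)
import Data.Vec.Functional as Functional
open import Data.Vec.Properties using (≡-dec; lookup-replicate; lookup∘tabulate; lookup∘updateAt; lookup∘updateAt′)
open import Relation.Binary.Construct.Closure.ReflexiveTransitive using (Star; ε; _◅_)
open import Relation.Binary.PropositionalEquality using (_≡_; _≢_; refl; cong; trans)
open import Relation.Nullary using (¬_; Dec; yes; no; contradiction)
open import Relation.Nullary.Decidable using (_×-dec_; recompute)

∏ : ∀ {k} → (Fin k → ℕ) → ℕ
∏ = Functional.foldr _*_ 1

d : ℕ → ℕ
d n = length (filter (_∣? n) (applyUpTo suc n))

-- The exponent of p in n: the largest e with p ^ e ∣ n.  For p ≥ 2 and n ≥ 1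
-- the search range e < n is exhaustive, because e < p ^ e ≤ n (see ν-greatest).
ν : ℕ → ℕ → ℕ
ν p n = max 0 (filter (λ e → p ^ e ∣? n) (upTo n))

ν-divides : ∀ p n → p ^ ν p n ∣ n
ν-divides p n = argmax-all (λ e → e) {P = λ e → p ^ e ∣ n} (1∣ n) (all-filter (λ e → p ^ e ∣? n) (upTo n))

private
  e<p^e : ∀ p e → 1 < p → e < p ^ e
  e<p^e p zero    1<p = ≤-refl
  e<p^e p (suc e) 1<p = begin-strict
    suc e          ≤⟨ e<p^e p e 1<p ⟩
    p ^ e          <⟨ m<m*n (p ^ e) p {{>-nonZero (≤-<-trans z≤n (e<p^e p e 1<p))}} 1<p ⟩
    p ^ e * p      ≡⟨ *-comm (p ^ e) p ⟩
    p ^ suc e      ∎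
    where open ≤-Reasoning

ν-greatest : ∀ {p n e} → 1 < p → 0 < n → p ^ e ∣ n → e ≤ ν p n
ν-greatest {p} {n} {e} 1<p 0<n p^e∣n =
  v≤max⁺ 0 _ (inj₂ (lose (∈-filter⁺ (λ e → p ^ e ∣? n) (∈-upTo⁺ e<n) p^e∣n) ≤-refl))
  where
  e<n : e < n
  e<n = <-≤-trans (e<p^e p e 1<p) (∣⇒≤ {{>-nonZero 0<n}} p^e∣n)

record Step (target z z′ : ℕ) : Set where
  field
    source-positive : 0 < z
    result-positive : 0 < z′
    prime           : ℕ
    isPrime         : Prime prime
    towards-target  : (ν prime z < ν prime target × ν prime z′ ≡ suc (ν prime z))
                    ⊎ (ν prime target < ν prime z × suc (ν prime z′) ≡ ν prime z)
    others-fixed    : ∀ q → Prime q → q ≢ prime → ν q z′ ≡ ν q z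

Geodesic : ℕ → ℕ → Set
Geodesic m n = Star (Step n) m n

vertices : ∀ {t m n} → Star (Step t) m n → List⁺ ℕ
vertices {m = m} ε       = [ m ]
vertices {m = m} (_ ◅ γ) = m ∷⁺ vertices γ

Admissible : ∀ {m n} → ℕ → Geodesic m n → Set
Admissible X γ = All (_≤ X) (vertices γ)

bottleneck : ∀ {m n} → Geodesic m n → ℕ
bottleneck γ = foldr₁ _⊓_ (List⁺.map d (vertices γ))

-- "𝒢_X(m,n) = g": g is the maximum of bottleneck γ over the X-admissible
-- geodesics γ from m to n.
record 𝒢[_,_,_]≡_ (X m n g : ℕ) : Set where
  field
    attained   : ∃[ γ ] Admissible {m} {n} X γ × bottleneck γ ≡ g
    upperBound : ∀ (γ : Geodesic m n) → Admissible X γ → bottleneck γ ≤ g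

𝒢-unique : ∀ {X m n g h} → 𝒢[ X , m , n ]≡ g → 𝒢[ X , m , n ]≡ h → g ≡ h
𝒢-unique G H = ≤-antisym (below G H) (below H G)
  where
  open 𝒢[_,_,_]≡_
  below : ∀ {X m n g h} → 𝒢[ X , m , n ]≡ g → 𝒢[ X , m , n ]≡ h → g ≤ h
  below G H with attained G
  ... | γ , adm , refl = upperBound H γ adm

sgn : ℤ → ℤ
sgn +0       = 0ℤ
sgn +[1+ _ ] = 1ℤ
sgn -[1+ _ ] = -1ℤ

module Recursion {k : ℕ} (p a b : Fin k → ℕ) (X : ℕ) where

  δ : Fin k → ℕ
  δ i = ∣ b i - a i ∣

  σ : Fin k → ℤ
  σ i = sgn (+ b i ℤ.- + a i)

  -- The bound is irrelevant so that states with equal coordinates are equal.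
  record State : Set where
    constructor state
    field
      coords   : Vec ℕ k
      .bounded : ∀ i → lookup coords i ≤ δ i

  open State public

  -- a i + σ i · r i, which is nonnegative on states (see exponent-correct).
  exponent : State → Fin k → ℕ
  exponent r i = ℤ.∣ + a i ℤ.+ σ i ℤ.* + lookup (coords r) i ∣

  N : State → ℕ
  N r = ∏ λ i → p i ^ exponent r i

  D : State → ℕ
  D r = ∏ λ i → exponent r i + 1

  origin : State
  origin = state (replicate k 0) λ i → ≤-trans (≤-reflexive (lookup-replicate i 0)) z≤n

  top : State
  top = state (tabulate δ) λ i → ≤-reflexive (lookup∘tabulate δ i)

  private
    lookup-pred : ∀ (r : Vec ℕ k) i j → lookup (updateAt r i pred) j ≤ lookup r j
    lookup-pred r i j with j Fin.≟ i
    ... | yes refl = ≤-trans (≤-reflexive (lookup∘updateAt i r)) pred[n]≤n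
    ... | no  j≢i  = ≤-reflexive (lookup∘updateAt′ j i j≢i r)

  -- Truncated when coordinate i is 0; only used where it is positive.
  _-e_ : State → Fin k → State
  state r r≤δ -e i = state (updateAt r i pred) λ j → ≤-trans (lookup-pred r i j) (r≤δ j)

  Predecessor : State → Fin k → Set
  Predecessor r i = 0 < lookup (coords r) i × N (r -e i) ≤ X

  predecessor? : ∀ r i → Dec (Predecessor r i)
  predecessor? r i = (0 <? lookup (coords r) i) ×-dec (N (r -e i) ≤? X)

  bestPredecessor : (State → ℕ) → State → ℕ
  bestPredecessor f r = max 0 (List.map (λ i → f (r -e i)) (filter (predecessor? r) (allFin k)))

  recurrence : (State → ℕ) → State → ℕ
  recurrence f r with N r ≤? X | ≡-dec _≟_ (coords r) (coords origin)
  ... | no  _ | _     = 0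
  ... | yes _ | yes _ = D r
  ... | yes _ | no  _ = D r ⊓ bestPredecessor f r

  -- Each use of the recurrence lowers the coordinate sum, so unfolding it
  -- 1 + Σ r times determines F r.
  unfold : ℕ → State → ℕ
  unfold zero    _ = 0
  unfold (suc s) r = recurrence (unfold s) r

  F : State → ℕ
  F r = unfold (suc (sum (coords r))) r

  private
    sum-pred : ∀ {l} (r : Vec ℕ l) i → 0 < lookup r i → sum (updateAt r i pred) < sum r
    sum-pred (suc x ∷ r) zero    _   = ≤-refl
    sum-pred (x ∷ r)     (suc i) pos = +-monoʳ-< x (sum-pred r i pos)

    recurrence-cong : ∀ {f g} r → (∀ i → 0 < lookup (coords r) i → f (r -e i) ≡ g (r -e i)) →
                      recurrence f r ≡ recurrence g r
    recurrence-cong r eq with N r ≤? X | ≡-dec _≟_ (coords r) (coords origin)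
    ... | no  _ | _     = refl
    ... | yes _ | yes _ = refl
    ... | yes _ | no  _ = cong (λ xs → D r ⊓ max 0 xs)
      (map-cong-local (LAll.map (λ {i} pre → eq i (proj₁ pre)) (all-filter (predecessor? r) (allFin k))))

    unfold-stable : ∀ s t r → sum (coords r) < s → sum (coords r) < t → unfold s r ≡ unfold t r
    unfold-stable (suc s) (suc t) r (s≤s r≤s) (s≤s r≤t) = recurrence-cong r λ i pos →
      let lt = sum-pred (coords r) i pos in
      unfold-stable s t (r -e i) (<-≤-trans lt r≤s) (<-≤-trans lt r≤t)

  F-recurrence : ∀ r → F r ≡ recurrence F r
  F-recurrence r = recurrence-cong r λ i pos →
    unfold-stable _ _ (r -e i) (sum-pred (coords r) i pos) ≤-refl

  F-inadmissible : ∀ r → ¬ (N r ≤ X) → F r ≡ 0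
  F-inadmissible r N≰X with N r ≤? X
  ... | no  _   = refl
  ... | yes N≤X = contradiction N≤X N≰X

  F-origin : N origin ≤ X → F origin ≡ D origin
  F-origin N≤X with N origin ≤? X | ≡-dec _≟_ (coords origin) (coords origin)
  ... | no N≰X | _      = contradiction N≤X N≰X
  ... | yes _  | yes _  = refl
  ... | yes _  | no 0≢0 = contradiction refl 0≢0

  F-step : ∀ r → N r ≤ X → r ≢ origin → F r ≡ D r ⊓ bestPredecessor F r
  F-step r N≤X r≢0 = trans (F-recurrence r) unfolded
    where
    unfolded : recurrence F r ≡ D r ⊓ bestPredecessor F r
    unfolded with N r ≤? X | ≡-dec _≟_ (coords r) (coords origin)
    ... | no N≰X | _        = contradiction N≤X N≰X
    ... | yes _  | yes refl = contradiction refl r≢0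
    ... | yes _  | no _     = refl

  private
    exponent-correct′ : ∀ x y r → r ≤ ∣ y - x ∣ → 0ℤ ℤ.≤ + x ℤ.+ sgn (+ y ℤ.- + x) ℤ.* + r
    exponent-correct′ x y r r≤δ rewrite ℤ.m-n≡m⊖n y x with ≤-total x y
    ... | inj₁ x≤y rewrite ℤ.⊖-≥ x≤y with y ∸ x
    ...   | zero  = ℤ.+≤+ z≤n
    ...   | suc _ rewrite ℤ.*-identityˡ (+ r) = ℤ.+≤+ z≤n
    exponent-correct′ x y r r≤δ | inj₂ y≤x rewrite ℤ.⊖-≤ y≤x | m≤n⇒∣m-n∣≡n∸m y≤x
      with x ∸ y | m∸n≤m x y
    ...   | zero  | _ = ℤ.+≤+ z≤n
    ...   | suc _ | le rewrite ℤ.-1*i≡-i (+ r) | ℤ.m-n≡m⊖n x r | ℤ.⊖-≥ (≤-trans r≤δ le) = ℤ.+≤+ z≤n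

  exponent-correct : ∀ r i → + exponent r i ≡ + a i ℤ.+ σ i ℤ.* + lookup (coords r) i
  exponent-correct (state r r≤δ) i =
    ℤ.0≤i⇒+∣i∣≡i (exponent-correct′ (a i) (b i) (lookup r i) (recompute (lookup r i ≤? δ i) (r≤δ i)))

{-# OPTIONS --safe #-}

-- A positive integer is determined by its prime exponents, so a step of a
-- geodesic out of N(r) leads exactly to N(r + e_i) for some i with r_i < δ_i:
-- geodesics from m to n are the monotone lattice paths from 0 to δ, and
-- d(N(r)) = D(r) along them.  Following such a path γ forwards from a state r,
-- the quantity min(F(r), min_{z ∈ γ} d(z)) never decreases, which gives the upper bound.
-- Conversely, as long as F(r) > 0 the recurrence selects a predecessor, and
-- prepending these to the trivial path at δ builds a geodesic attaining F(δ).
-- Finally F(δ) > 0: the path that performs all decreasing steps first stays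
-- below max(m, n).
module Submission where

open import Defs
open import Data.Fin.Base using (Fin; zero; suc; fromℕ<; toℕ)
import Data.Fin.Properties as Fin
import Data.Integer.Base as ℤ
import Data.Integer.Properties as ℤ
open import Data.List.Base using (List; []; _∷_; _++_; allFin; applyUpTo; filter; length; map)
open import Data.List.Extrema.Nat using (v≤max⁺; argmax-sel)
open import Data.List.Membership.Propositional using (_∈_; lose)
open import Data.List.Membership.Propositional.Properties using (∈-allFin; ∈-applyUpTo⁺; ∈-filter⁺; ∈-filter⁻; ∈-++⁺ˡ; ∈-++⁺ʳ; ∈-++⁻; ∈-map⁺; ∈-map⁻)
open import Data.List.Membership.Propositional.Properties.WithK using (unique∧set⇒bag)
open import Data.List.NonEmpty.Base using (_∷_)
open import Data.List.NonEmpty.Relation.Unary.All using (_∷_)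
open import Data.List.Properties using (length-++; length-map)
open import Data.List.Relation.Binary.BagAndSetEquality using (∼bag⇒↭)
open import Data.List.Relation.Binary.Permutation.Propositional.Properties using (↭-length)
open import Data.List.Relation.Unary.All using ([]; _∷_)
open import Data.List.Relation.Unary.Unique.Propositional using (Unique)
import Data.List.Relation.Unary.Unique.Propositional.Properties as Unique
open import Data.Nat.Base
open import Data.Nat.Divisibility
open import Data.Nat.Induction using (<-rec)
open import Data.Nat.Primality
open import Data.Nat.Primality.Factorisation using (factorise)
open import Data.Nat.Properties
open import Data.Nat.Solver using (module +-*-Solver)
open import Data.Product.Base using (∃-syntax; _×_; _,_; proj₁; proj₂)
open import Data.Product.Function.NonDependent.Propositional using (_×-cong_)
open import Data.Sum.Base using (_⊎_; inj₁; inj₂; [_,_])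
open import Data.Vec.Base using (Vec; []; _∷_; lookup; sum; updateAt)
open import Data.Vec.Properties using (lookup-replicate; lookup∘tabulate; lookup∘updateAt; lookup∘updateAt′; updateAt-updateAt; updateAt-id; tabulate∘lookup; tabulate-cong; ≡-dec)
open import Function.Base using (_∘_)
open import Function.Bundles using (_↔_; mk↔ₛ′; mk⇔)
open import Function.Definitions using (Injective)
open import Function.Properties.Inverse using (↔-refl; ↔-sym; ↔-trans)
open import Relation.Binary.Construct.Closure.ReflexiveTransitive using (ε; _◅_)
open import Relation.Binary.PropositionalEquality using (_≡_; _≢_; refl; sym; trans; cong; cong₂; subst; subst₂; module ≡-Reasoning)
open import Relation.Nullary using (¬_; Dec; yes; no; contradiction)
open import Relation.Nullary.Decidable using (_×-dec_; recompute)

private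
  variable
    k m n p q e : ℕ

-- Primes, powers and finite products

prime>1 : Prime p → 1 < p
prime>1 {p} pr = nonTrivial⇒n>1 p {{prime⇒nonTrivial pr}}

prime>0 : Prime p → 0 < p
prime>0 pr = <-trans z<s (prime>1 pr)

prime-∣-prime : Prime p → Prime q → p ∣ q → p ≡ q
prime-∣-prime pr-p pr-q p∣q with prime⇒irreducible pr-q p∣q
... | inj₁ refl = contradiction pr-p ¬prime[1]
... | inj₂ p≡q  = p≡q

primeDivisor : ∀ n → 1 < n → ∃[ q ] Prime q × q ∣ n
primeDivisor n 1<n with factorise n {{>-nonZero (<-trans z<s 1<n)}}
... | record { factors = [] ; isFactorisation = refl } = contradiction 1<n (<-irrefl refl)
... | record { factors = q ∷ _ ; isFactorisation = n≡ ; factorsPrime = pr ∷ _ } =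
  q , pr , subst (q ∣_) (sym n≡) (m∣m*n _)

^-mono-∣ : ∀ p → m ≤ n → p ^ m ∣ p ^ n
^-mono-∣ {m} {n} p m≤n = subst (p ^ m ∣_) (trans (sym (^-distribˡ-+-* p m (n ∸ m))) (cong (p ^_) (m+[n∸m]≡n m≤n)))
  (m∣m*n (p ^ (n ∸ m)))

∏-cong : {f g : Fin k → ℕ} → (∀ i → f i ≡ g i) → ∏ f ≡ ∏ g
∏-cong {zero}  eq = refl
∏-cong {suc k} eq = cong₂ _*_ (eq zero) (∏-cong (eq ∘ suc))

∏-mono-≤ : {f g : Fin k → ℕ} → (∀ i → f i ≤ g i) → ∏ f ≤ ∏ g
∏-mono-≤ {zero}  le = ≤-refl
∏-mono-≤ {suc k} le = *-mono-≤ (le zero) (∏-mono-≤ (le ∘ suc))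

∏-pos : {f : Fin k → ℕ} → (∀ i → 0 < f i) → 0 < ∏ f
∏-pos {zero}  pos = z<s
∏-pos {suc k} pos = *-mono-≤ (pos zero) (∏-pos (pos ∘ suc))

-- The exponent of a prime

ν-unique : 1 < p → 0 < n → p ^ e ∣ n → ¬ (p ^ suc e ∣ n) → ν p n ≡ e
ν-unique {p} {n} 1<p 0<n yes-e no-e = ≤-antisym
  (≮⇒≥ λ e<ν → no-e (∣-trans (^-mono-∣ p e<ν) (ν-divides p n)))
  (ν-greatest 1<p 0<n yes-e)

ν-zero : 1 < p → 0 < n → p ∤ n → ν p n ≡ 0
ν-zero {p} {n} 1<p 0<n p∤n = ν-unique 1<p 0<n (1∣ n) (p∤n ∘ subst (_∣ n) (*-identityʳ p))

ν≡0⇒∤ : 1 < p → 0 < n → ν p n ≡ 0 → p ∤ n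
ν≡0⇒∤ {p} {n} 1<p 0<n ν≡0 p∣n =
  n≮0 (subst (1 ≤_) ν≡0 (ν-greatest {e = 1} 1<p 0<n (subst (_∣ n) (sym (*-identityʳ p)) p∣n)))

-- A further factor `q` in the cofactor would make `q ^ suc (ν q n)` divide `n`, against
-- `ν-greatest`.
ν-cofactor : Prime q → 0 < n → ∃[ c ] n ≡ q ^ ν q n * c × q ∤ c
ν-cofactor {q} {n} pr 0<n with ν-divides q n
... | divides c n≡ = c , trans n≡ (*-comm c _) , λ q∣c → <-irrefl refl (ν-greatest (prime>1 pr) 0<n
        (subst (q ^ suc (ν q n) ∣_) (sym n≡) (*-monoˡ-∣ (q ^ ν q n) q∣c)))

-- By Euclid's lemma the product of the two `q`-free cofactors is again `q`-free, so the power of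
-- `q` collected in `Q` is the full one.
ν-* : Prime q → 0 < m → 0 < n → ν q (m * n) ≡ ν q m + ν q n
ν-* {q} {m} {n} pr 0<m 0<n with ν-cofactor pr 0<m | ν-cofactor pr 0<n
... | c , m≡ , q∤c | c′ , n≡ , q∤c′ =
  ν-unique (prime>1 pr) (*-mono-≤ 0<m 0<n)
    (subst (Q ∣_) (sym mn≡) (m∣m*n (c * c′)))
    λ q^∣mn → [ q∤c , q∤c′ ] (euclidsLemma c c′ pr
      (*-cancelˡ-∣ Q {{m^n≢0 q (ν q m + ν q n) {{prime⇒nonZero pr}}}}
        (subst (_∣ Q * (c * c′)) (*-comm q Q) (subst (q ^ suc (ν q m + ν q n) ∣_) mn≡ q^∣mn))))
  where
  Q = q ^ (ν q m + ν q n)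
  mn≡ : m * n ≡ Q * (c * c′)
  mn≡ = begin
    m * n                                   ≡⟨ cong₂ _*_ m≡ n≡ ⟩
    (q ^ ν q m * c) * (q ^ ν q n * c′)      ≡⟨ solve 4 (λ x y z w → (x :* y) :* (z :* w) := (x :* z) :* (y :* w)) refl (q ^ ν q m) c (q ^ ν q n) c′ ⟩
    (q ^ ν q m * q ^ ν q n) * (c * c′)      ≡⟨ cong (_* (c * c′)) (^-distribˡ-+-* q (ν q m) (ν q n)) ⟨
    Q * (c * c′)                            ∎
    where open ≡-Reasoning; open +-*-Solver using (solve; _:*_; _:=_)

ν-self : Prime q → ν q q ≡ 1
ν-self {q} pr = ν-unique (prime>1 pr) (prime>0 pr) (∣-reflexive (*-identityʳ q)) λ q²∣q →
  >⇒∤ {{prime⇒nonZero pr}} (subst (q <_) (cong (q *_) (sym (*-identityʳ q))) (m<m*n q q {{prime⇒nonZero pr}} (prime>1 pr))) q²∣q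

ν-^-self : Prime q → ∀ e → ν q (q ^ e) ≡ e
ν-^-self {q} pr e = ν-unique (prime>1 pr) (m^n>0 q {{prime⇒nonZero pr}} e) ∣-refl
  λ q^1+e∣q^e → >⇒∤ {{m^n≢0 q e {{prime⇒nonZero pr}}}} (^-monoʳ-< q (prime>1 pr) (n<1+n e)) q^1+e∣q^e

ν-^-other : Prime p → Prime q → p ≢ q → ∀ e → ν q (p ^ e) ≡ 0
ν-^-other {p} {q} pr-p pr-q p≢q e = ν-zero (prime>1 pr-q) (m^n>0 p {{prime⇒nonZero pr-p}} e) (∤ e)
  where
  ∤ : ∀ e → q ∤ p ^ e
  ∤ zero    q∣1 = ¬prime[1] (subst Prime (∣1⇒≡1 q∣1) pr-q)
  ∤ (suc e) q∣p^ with euclidsLemma p (p ^ e) pr-q q∣p^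
  ... | inj₁ q∣p = p≢q (sym (prime-∣-prime pr-q pr-p q∣p))
  ... | inj₂ q∣  = ∤ e q∣

primePower-pos : {p : Fin k → ℕ} → (∀ i → Prime (p i)) → (e : Fin k → ℕ) → ∀ i → 0 < p i ^ e i
primePower-pos {p = p} pr e i = m^n>0 (p i) {{prime⇒nonZero (pr i)}} (e i)

ν-∏-other : {p : Fin k → ℕ} → (∀ i → Prime (p i)) → Prime q → (∀ i → p i ≢ q) →
            (e : Fin k → ℕ) → ν q (∏ λ i → p i ^ e i) ≡ 0
ν-∏-other {zero} pr pr-q ≢ e = ν-zero (prime>1 pr-q) z<s λ q∣1 → ¬prime[1] (subst Prime (∣1⇒≡1 q∣1) pr-q)
ν-∏-other {suc k} {p = p} pr pr-q ≢ e = trans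
  (ν-* pr-q (primePower-pos pr e zero) (∏-pos (primePower-pos (pr ∘ suc) (e ∘ suc))))
  (cong₂ _+_ (ν-^-other (pr zero) pr-q (≢ zero) (e zero)) (ν-∏-other (pr ∘ suc) pr-q (≢ ∘ suc) (e ∘ suc)))

ν-∏ : {p : Fin k → ℕ} → (∀ i → Prime (p i)) → Injective _≡_ _≡_ p →
      (e : Fin k → ℕ) → ∀ j → ν (p j) (∏ λ i → p i ^ e i) ≡ e j
ν-∏ {suc k} {p} pr inj e zero = trans
  (ν-* (pr zero) (primePower-pos pr e zero) (∏-pos (primePower-pos (pr ∘ suc) (e ∘ suc))))
  (trans (cong₂ _+_ (ν-^-self (pr zero) (e zero)) (ν-∏-other (pr ∘ suc) (pr zero) (λ i eq → Fin.0≢1+n (inj (sym eq))) (e ∘ suc)))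
         (+-identityʳ (e zero)))
ν-∏ {suc k} {p} pr inj e (suc j) = trans
  (ν-* (pr (suc j)) (primePower-pos pr e zero) (∏-pos (primePower-pos (pr ∘ suc) (e ∘ suc))))
  (cong₂ _+_ (ν-^-other (pr zero) (pr (suc j)) (λ eq → Fin.0≢1+n (inj eq)) (e zero))
             (ν-∏ (pr ∘ suc) (λ eq → Fin.suc-injective (inj eq)) (e ∘ suc) j))

-- Strong induction on `m`: a prime factor `q` of `m` also divides `n`, and cancelling it from both
-- subtracts `ν q′ q` from both exponents at each prime `q′`, which preserves the inequalities.
ν-≤⇒∣ : ∀ m n → 0 < m → 0 < n → (∀ q → Prime q → ν q m ≤ ν q n) → m ∣ n
ν-≤⇒∣ = <-rec (λ m → ∀ n → 0 < m → 0 < n → (∀ q → Prime q → ν q m ≤ ν q n) → m ∣ n) step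
  where
  step : ∀ m → (∀ {m′} → m′ < m → ∀ n → 0 < m′ → 0 < n → (∀ q → Prime q → ν q m′ ≤ ν q n) → m′ ∣ n) →
         ∀ n → 0 < m → 0 < n → (∀ q → Prime q → ν q m ≤ ν q n) → m ∣ n
  step 1 rec n _ _ _ = 1∣ n
  step m@(2+ _) rec n 0<m 0<n le with primeDivisor m (s≤s (s≤s z≤n))
  ... | q , pr , divides c m≡ with c
  step (2+ _) rec n 0<m 0<n le | q , pr , divides c () | zero
  ... | c@(suc _) with q ∣? n
  -- As `q` divides `m`, `ν q m` is a successor, while `q ∤ n` forces `ν q n` to be 0.
  ...   | no  q∤n = contradiction (subst (_≤ 0) νm (subst (ν q m ≤_) (ν-zero (prime>1 pr) 0<n q∤n) (le q pr))) λ ()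
    where
    νm : ν q m ≡ suc (ν q c)
    νm = trans (cong (ν q) m≡) (trans (ν-* {m = c} pr z<s (prime>0 pr)) (trans (cong (ν q c +_) (ν-self pr)) (+-comm (ν q c) 1)))
  ...   | yes (divides zero refl) = contradiction 0<n λ ()
  ...   | yes (divides c′@(suc _) refl) = subst (_∣ c′ * q) (sym m≡) (*-monoˡ-∣ q
            (rec (subst (c <_) (sym m≡) (m<m*n c q (prime>1 pr))) c′ z<s z<s λ q′ pr′ →
              +-cancelʳ-≤ (ν q′ q) (ν q′ c) (ν q′ c′)
                (subst (_≤ ν q′ c′ + ν q′ q) (trans (cong (ν q′) m≡) (ν-* {m = c} pr′ z<s (prime>0 pr)))
                  (subst (ν q′ m ≤_) (ν-* {m = c′} pr′ z<s (prime>0 pr)) (le q′ pr′)))))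

ν-ext : 0 < m → 0 < n → (∀ q → Prime q → ν q m ≡ ν q n) → m ≡ n
ν-ext {m} {n} 0<m 0<n eq = ∣-antisym
  (ν-≤⇒∣ m n 0<m 0<n λ q pr → ≤-reflexive (eq q pr))
  (ν-≤⇒∣ n m 0<n 0<m λ q pr → ≤-reflexive (sym (eq q pr)))

-- The number of divisors

divisors : ℕ → List ℕ
divisors n = filter (_∣? n) (applyUpTo suc n)

divisors-unique : ∀ n → Unique (divisors n)
divisors-unique n = Unique.filter⁺ (_∣? n) (Unique.applyUpTo⁺₁ suc n λ i<j _ eq → <⇒≢ i<j (suc-injective eq))

∈-divisors⁺ : 0 < n → m ∣ n → m ∈ divisors n
∈-divisors⁺ {n} {zero}  0<n 0∣n = contradiction (0∣⇒≡0 0∣n) (>⇒≢ 0<n)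
∈-divisors⁺ {n} {suc m} 0<n m∣n = ∈-filter⁺ (_∣? n) (∈-applyUpTo⁺ suc (∣⇒≤ {{>-nonZero 0<n}} m∣n)) m∣n

∈-divisors⁻ : ∀ n → m ∈ divisors n → m ∣ n
∈-divisors⁻ n m∈ = proj₂ (∈-filter⁻ (_∣? n) {xs = applyUpTo suc n} m∈)

-- Euclid's lemma moves the factors `q` into `x` one at a time; `x` is quantified after `e` because
-- each round replaces it by `x / q`.
prime^∣*⇒∣ : Prime q → ∀ e {c} → q ∤ c → ∀ {x} → q ^ e ∣ x * c → q ^ e ∣ x
prime^∣*⇒∣ pr zero    q∤c {x} _ = 1∣ x
prime^∣*⇒∣ {q} pr (suc e) {c} q∤c {x} q^∣xc with euclidsLemma x c pr (∣-trans (m∣m*n (q ^ e)) q^∣xc)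
... | inj₂ q∣c = contradiction q∣c q∤c
... | inj₁ (divides y refl) = subst (q * q ^ e ∣_) (*-comm q y) (*-monoʳ-∣ q (prime^∣*⇒∣ pr e q∤c
        (*-cancelˡ-∣ q {{prime⇒nonZero pr}} (subst (q * q ^ e ∣_) (trans (cong (_* c) (*-comm y q)) (*-assoc q y c)) q^∣xc))))

-- A divisor of q ^ suc e * n either has full q-part, or already divides q ^ e * n.
d-primePower-suc : Prime q → 0 < n → q ∤ n → ∀ e → d (q ^ suc e * n) ≡ d (q ^ e * n) + d n
d-primePower-suc {q} {n} pr 0<n q∤n e = begin
  length (divisors (q ^ suc e * n))
    -- Two duplicate-free lists with the same elements are permutations of each other, hence equally
    -- long.
    ≡⟨ ↭-length (∼bag⇒↭ (unique∧set⇒bag (divisors-unique (q ^ suc e * n)) split-unique (mk⇔ to from))) ⟩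
  length (divisors (q ^ e * n) ++ map (q ^ suc e *_) (divisors n))
    ≡⟨ length-++ (divisors (q ^ e * n)) ⟩
  d (q ^ e * n) + length (map (q ^ suc e *_) (divisors n))
    ≡⟨ cong (d (q ^ e * n) +_) (length-map _ (divisors n)) ⟩
  d (q ^ e * n) + d n ∎
  where
  open ≡-Reasoning
  instance
    _ = prime⇒nonZero pr
    q^e≢0 : NonZero (q ^ e)
    q^e≢0 = m^n≢0 q e
    q^1+e≢0 : NonZero (q ^ suc e)
    q^1+e≢0 = m^n≢0 q (suc e)

  q^n>0 : ∀ e → 0 < q ^ e * n
  q^n>0 e = *-mono-≤ (m^n>0 q e) 0<n

  -- Cancelling `q ^ e` would leave `q ∣ n`. This makes the two halves of the split disjoint.
  full∤ : ∀ {y} → q ^ suc e * y ∤ q ^ e * n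
  full∤ {y} h = q∤n (*-cancelˡ-∣ (q ^ e) (subst (_∣ q ^ e * n) (*-comm q (q ^ e)) (m*n∣⇒m∣ (q ^ suc e) y h)))

  split-unique : Unique (divisors (q ^ e * n) ++ map (q ^ suc e *_) (divisors n))
  split-unique = Unique.++⁺ (divisors-unique (q ^ e * n))
    (Unique.map⁺ (*-cancelˡ-≡ _ _ (q ^ suc e)) (divisors-unique n))
    λ (x∈ , x∈map) → let y , _ , x≡ = ∈-map⁻ _ x∈map in full∤ (subst (_∣ q ^ e * n) x≡ (∈-divisors⁻ (q ^ e * n) x∈))

  to : ∀ {x} → x ∈ divisors (q ^ suc e * n) → x ∈ divisors (q ^ e * n) ++ map (q ^ suc e *_) (divisors n)
  to {x} x∈ with ∈-divisors⁻ (q ^ suc e * n) x∈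
  -- Here `c` is the complementary divisor. If it contains a `q`, one factor `q` cancels and `x`
  -- divides `q ^ e * n`; otherwise all of `q ^ suc e` lies in `x`.
  ... | divides c eq with q ∣? c
  ...   | yes (divides c′ refl) = ∈-++⁺ˡ (∈-divisors⁺ (q^n>0 e) (divides c′ (*-cancelˡ-≡ _ _ q (begin
            q * (q ^ e * n) ≡⟨ *-assoc q (q ^ e) n ⟨
            q ^ suc e * n   ≡⟨ eq ⟩
            c′ * q * x      ≡⟨ cong (_* x) (*-comm c′ q) ⟩
            q * c′ * x      ≡⟨ *-assoc q c′ x ⟩
            q * (c′ * x)    ∎))))
  ...   | no q∤c with prime^∣*⇒∣ pr (suc e) q∤c {x} (subst (q ^ suc e ∣_) (trans eq (*-comm c x)) (m∣m*n n))
  ...     | divides y refl = ∈-++⁺ʳ (divisors (q ^ e * n)) (subst (_∈ map (q ^ suc e *_) (divisors n)) (*-comm (q ^ suc e) y)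
            (∈-map⁺ (q ^ suc e *_) (∈-divisors⁺ 0<n (*-cancelˡ-∣ (q ^ suc e)
              (subst (_∣ q ^ suc e * n) (*-comm y (q ^ suc e)) (divides c eq))))))

  from : ∀ {x} → x ∈ divisors (q ^ e * n) ++ map (q ^ suc e *_) (divisors n) → x ∈ divisors (q ^ suc e * n)
  from x∈ with ∈-++⁻ (divisors (q ^ e * n)) x∈
  ... | inj₁ x∈ˡ = ∈-divisors⁺ (q^n>0 (suc e)) (∣-trans (∈-divisors⁻ (q ^ e * n) x∈ˡ) (*-monoˡ-∣ n (^-mono-∣ q (n≤1+n e))))
  ... | inj₂ x∈ʳ with ∈-map⁻ (q ^ suc e *_) x∈ʳ
  ...   | y , y∈ , refl = ∈-divisors⁺ (q^n>0 (suc e)) (*-monoʳ-∣ (q ^ suc e) (∈-divisors⁻ n y∈))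

d-primePower : Prime q → 0 < n → q ∤ n → ∀ e → d (q ^ e * n) ≡ (e + 1) * d n
d-primePower {n = n} pr 0<n q∤n zero    = trans (cong d (*-identityˡ n)) (sym (*-identityˡ (d n)))
d-primePower {n = n} pr 0<n q∤n (suc e) = trans (d-primePower-suc pr 0<n q∤n e)
  (trans (cong (_+ d n) (d-primePower pr 0<n q∤n e)) (+-comm ((e + 1) * d n) (d n)))

-- Split off the first prime power: by injectivity its prime does not divide the rest, so
-- `d-primePower` applies.
d-∏ : {p : Fin k → ℕ} → (∀ i → Prime (p i)) → Injective _≡_ _≡_ p →
      (e : Fin k → ℕ) → d (∏ λ i → p i ^ e i) ≡ ∏ λ i → e i + 1
d-∏ {zero}      pr inj e = refl
d-∏ {suc k} {p} pr inj e = trans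
  (d-primePower (pr zero) rest>0 (ν≡0⇒∤ (prime>1 (pr zero)) rest>0
    (ν-∏-other (pr ∘ suc) (pr zero) (λ i eq → Fin.0≢1+n (inj (sym eq))) (e ∘ suc))) (e zero))
  (cong ((e zero + 1) *_) (d-∏ (pr ∘ suc) (λ eq → Fin.suc-injective (inj eq)) (e ∘ suc)))
  where
  rest>0 : 0 < ∏ λ i → p (suc i) ^ e (suc i)
  rest>0 = ∏-pos (primePower-pos (pr ∘ suc) (e ∘ suc))

-- Geodesics

-- The condition `towards-target` of a `Step`, abstracted to the target, old and new exponent of one
-- prime.
Toward : ℕ → ℕ → ℕ → Set
Toward t e e′ = (e < t × e′ ≡ suc e) ⊎ (t < e × suc e′ ≡ e)

Toward-unique : ∀ {t e e′ e″} → Toward t e e′ → Toward t e e″ → e′ ≡ e″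
Toward-unique (inj₁ (_ , eq))  (inj₁ (_ , eq′)) = trans eq (sym eq′)
Toward-unique (inj₁ (lt , _))  (inj₂ (gt , _))  = contradiction gt (<-asym lt)
Toward-unique (inj₂ (gt , _))  (inj₁ (lt , _))  = contradiction gt (<-asym lt)
Toward-unique (inj₂ (_ , eq))  (inj₂ (_ , eq′)) = suc-injective (trans eq (sym eq′))

Toward⇒≢ : ∀ {t e e′} → Toward t e e′ → e ≢ t
Toward⇒≢ (inj₁ (e<t , _)) = <⇒≢ e<t
Toward⇒≢ (inj₂ (t<e , _)) = >⇒≢ t<e

bottleneck-◅ : ∀ {z} (s : Step n m z) (γ : Geodesic z n) → bottleneck (s ◅ γ) ≡ d m ⊓ bottleneck γ
bottleneck-◅ s γ with vertices γ
... | _ ∷ _ = refl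

admissible-◅⁺ : ∀ {X z} (s : Step n m z) (γ : Geodesic z n) → m ≤ X → Admissible X γ → Admissible X (s ◅ γ)
admissible-◅⁺ s γ m≤X adm with vertices γ | adm
... | _ ∷ _ | px ∷ pxs = m≤X ∷ px ∷ pxs

admissible-◅⁻ : ∀ {X z} (s : Step n m z) (γ : Geodesic z n) → Admissible X (s ◅ γ) → Admissible X γ
admissible-◅⁻ s γ adm with vertices γ | adm
... | _ ∷ _ | _ ∷ px ∷ pxs = px ∷ pxs

admissible-source : ∀ {X} (γ : Geodesic m n) → Admissible X γ → m ≤ X
admissible-source ε       (px ∷ _) = px
admissible-source (s ◅ γ) adm with vertices γ | adm
... | _ ∷ _ | px ∷ _ = px

bottleneck≤source : (γ : Geodesic m n) → bottleneck γ ≤ d m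
bottleneck≤source ε       = ≤-refl
bottleneck≤source (s ◅ γ) = ≤-trans (≤-reflexive (bottleneck-◅ s γ)) (m⊓n≤m _ _)

lookup-ext : {x y : Vec ℕ k} → (∀ i → lookup x i ≡ lookup y i) → x ≡ y
lookup-ext {x = x} {y} eq = trans (sym (tabulate∘lookup x)) (trans (tabulate-cong eq) (tabulate∘lookup y))

sum-updateAt-pred : (x : Vec ℕ k) → ∀ i → 0 < lookup x i → sum (updateAt x i pred) < sum x
sum-updateAt-pred (suc _ ∷ x) zero    _   = ≤-refl
sum-updateAt-pred (y ∷ x)     (suc i) pos = +-monoʳ-< y (sum-updateAt-pred x i pos)

-- The exponent of a state

private
  exponent-up : ∀ x y r → r ≤ ∣ y - x ∣ → x ≤ y → ℤ.∣ ℤ.+ x ℤ.+ sgn (ℤ.+ y ℤ.- ℤ.+ x) ℤ.* ℤ.+ r ∣ ≡ x + r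
  exponent-up x y r r≤δ x≤y rewrite ℤ.m-n≡m⊖n y x | ℤ.⊖-≥ x≤y | m≤n⇒∣n-m∣≡n∸m x≤y with y ∸ x
  -- The exponents agree here: the sign is 0, and the bound forces `r` to be 0 as well.
  ... | zero  rewrite n≤0⇒n≡0 r≤δ = refl
  ... | suc _ rewrite ℤ.*-identityˡ (ℤ.+ r) = refl

  -- Stated additively to avoid truncated subtraction. The bound gives `r ≤ x`, so the absolute
  -- value changes nothing.
  exponent-down : ∀ x y r → r ≤ ∣ y - x ∣ → y ≤ x → ℤ.∣ ℤ.+ x ℤ.+ sgn (ℤ.+ y ℤ.- ℤ.+ x) ℤ.* ℤ.+ r ∣ + r ≡ x
  exponent-down x y r r≤δ y≤x rewrite ℤ.m-n≡m⊖n y x | ℤ.⊖-≤ y≤x | m≤n⇒∣m-n∣≡n∸m y≤x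
    with x ∸ y | m∸n≤m x y
  ... | zero  | _  rewrite n≤0⇒n≡0 r≤δ | +-identityʳ x | +-identityʳ x = refl
  ... | suc _ | le rewrite ℤ.-1*i≡-i (ℤ.+ r) | ℤ.m-n≡m⊖n x r | ℤ.⊖-≥ (≤-trans r≤δ le) = m∸n+n≡m (≤-trans r≤δ le)

module States {k : ℕ} (p a b : Fin k → ℕ) (X : ℕ) where

  open Recursion p a b X

  infix 9 _at_
  _at_ : State → Fin k → ℕ
  r at i = lookup (coords r) i

  -- The bound stored in a state is irrelevant; decidability of `≤` recovers a usable proof.
  at≤δ : ∀ r i → r at i ≤ δ i
  at≤δ (state x x≤δ) i = recompute (lookup x i ≤? δ i) (x≤δ i)

  State-ext : ∀ {r s} → (∀ i → r at i ≡ s at i) → r ≡ s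
  State-ext {state x _} {state y _} eq with refl ← lookup-ext {x = x} {y} eq = refl

  origin-at : ∀ i → origin at i ≡ 0
  origin-at i = lookup-replicate i 0

  top-at : ∀ i → top at i ≡ δ i
  top-at = lookup∘tabulate δ

  -e-at : ∀ r i → (r -e i) at i ≡ pred (r at i)
  -e-at (state x _) i = lookup∘updateAt i x

  -e-at′ : ∀ r {i j} → j ≢ i → (r -e i) at j ≡ r at j
  -e-at′ (state x _) {i} {j} j≢i = lookup∘updateAt′ j i j≢i x

  -e-≤ : ∀ r i j → (r -e i) at j ≤ r at j
  -e-≤ r i j with j Fin.≟ i
  ... | yes refl = ≤-trans (≤-reflexive (-e-at r i)) pred[n]≤n
  ... | no  j≢i  = ≤-reflexive (-e-at′ r j≢i)

  exponent-up-at : ∀ r i → a i ≤ b i → exponent r i ≡ a i + r at i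
  exponent-up-at r i = exponent-up (a i) (b i) (r at i) (at≤δ r i)

  exponent-down-at : ∀ r i → b i ≤ a i → exponent r i + r at i ≡ a i
  exponent-down-at r i = exponent-down (a i) (b i) (r at i) (at≤δ r i)

  exponent-cong : ∀ r s i → r at i ≡ s at i → exponent r i ≡ exponent s i
  exponent-cong r s i eq = cong (λ x → ℤ.∣ ℤ.+ a i ℤ.+ σ i ℤ.* ℤ.+ x ∣) eq

  exponent-origin : ∀ i → exponent origin i ≡ a i
  exponent-origin i with ≤-total (a i) (b i)
  ... | inj₁ a≤b = trans (exponent-up-at origin i a≤b) (trans (cong (λ x → a i + x) (origin-at i)) (+-identityʳ (a i)))
  ... | inj₂ b≤a = trans (trans (sym (+-identityʳ _)) (cong (λ x → exponent origin i + x) (sym (origin-at i)))) (exponent-down-at origin i b≤a)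

  exponent-full : ∀ r i → r at i ≡ δ i → exponent r i ≡ b i
  exponent-full r i full with ≤-total (a i) (b i)
  ... | inj₁ a≤b = begin
    exponent r i      ≡⟨ exponent-up-at r i a≤b ⟩
    a i + r at i      ≡⟨ cong (a i +_) (trans full (m≤n⇒∣n-m∣≡n∸m a≤b)) ⟩
    a i + (b i ∸ a i) ≡⟨ m+[n∸m]≡n a≤b ⟩
    b i               ∎
    where open ≡-Reasoning
  ... | inj₂ b≤a = +-cancelʳ-≡ (r at i) _ _ (begin
    exponent r i + r at i ≡⟨ exponent-down-at r i b≤a ⟩
    a i                   ≡⟨ m+[n∸m]≡n b≤a ⟨
    b i + (a i ∸ b i)     ≡⟨ cong (b i +_) (trans full (m≤n⇒∣m-n∣≡n∸m b≤a)) ⟨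
    b i + r at i          ∎)
    where open ≡-Reasoning

  exponent-injective : ∀ r s i → exponent r i ≡ exponent s i → r at i ≡ s at i
  exponent-injective r s i eq with ≤-total (a i) (b i)
  ... | inj₁ a≤b = +-cancelˡ-≡ (a i) _ _
    (trans (sym (exponent-up-at r i a≤b)) (trans eq (exponent-up-at s i a≤b)))
  ... | inj₂ b≤a = +-cancelˡ-≡ (exponent r i) _ _
    (trans (exponent-down-at r i b≤a) (trans (sym (exponent-down-at s i b≤a)) (cong (_+ s at i) (sym eq))))

  -- The later state `s` still satisfies its bound, so its exponent has not passed `b i`; hence that
  -- of `r` lies strictly on the near side of the target.
  exponent-step : ∀ r s i → s at i ≡ suc (r at i) → Toward (b i) (exponent r i) (exponent s i)
  exponent-step r s i eq with ≤-total (a i) (b i)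
  ... | inj₁ a≤b = inj₁ (≤-trans (≤-reflexive (sym up)) s≤b , up)
    where
    up : exponent s i ≡ suc (exponent r i)
    up = begin
      exponent s i         ≡⟨ exponent-up-at s i a≤b ⟩
      a i + s at i         ≡⟨ cong (a i +_) eq ⟩
      a i + suc (r at i)   ≡⟨ +-suc (a i) (r at i) ⟩
      suc (a i + r at i)   ≡⟨ cong suc (exponent-up-at r i a≤b) ⟨
      suc (exponent r i)   ∎
      where open ≡-Reasoning
    s≤b : exponent s i ≤ b i
    s≤b = begin
      exponent s i      ≡⟨ exponent-up-at s i a≤b ⟩
      a i + s at i      ≤⟨ +-monoʳ-≤ (a i) (at≤δ s i) ⟩
      a i + δ i         ≡⟨ cong (a i +_) (m≤n⇒∣n-m∣≡n∸m a≤b) ⟩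
      a i + (b i ∸ a i) ≡⟨ m+[n∸m]≡n a≤b ⟩
      b i               ∎
      where open ≤-Reasoning
  ... | inj₂ b≤a = inj₂ (≤-trans (s≤s b≤s) (≤-reflexive down) , down)
    where
    down : suc (exponent s i) ≡ exponent r i
    down = +-cancelʳ-≡ (r at i) _ _ (begin
      suc (exponent s i) + r at i   ≡⟨ +-suc (exponent s i) (r at i) ⟨
      exponent s i + suc (r at i)   ≡⟨ cong (exponent s i +_) eq ⟨
      exponent s i + s at i         ≡⟨ exponent-down-at s i b≤a ⟩
      a i                           ≡⟨ exponent-down-at r i b≤a ⟨
      exponent r i + r at i         ∎)
      where open ≡-Reasoning
    b≤s : b i ≤ exponent s i
    b≤s = +-cancelʳ-≤ (s at i) _ _ (begin
      b i + s at i          ≤⟨ +-monoʳ-≤ (b i) (at≤δ s i) ⟩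
      b i + δ i             ≡⟨ cong (b i +_) (m≤n⇒∣m-n∣≡n∸m b≤a) ⟩
      b i + (a i ∸ b i)     ≡⟨ m+[n∸m]≡n b≤a ⟩
      a i                   ≡⟨ exponent-down-at s i b≤a ⟨
      exponent s i + s at i ∎)
      where open ≤-Reasoning

  suc-pred-at : ∀ r i → 0 < r at i → r at i ≡ suc ((r -e i) at i)
  suc-pred-at r i pos = trans (sym (suc-pred (r at i) {{>-nonZero pos}})) (cong suc (sym (-e-at r i)))

  module _ (r : State) (i : Fin k) (r<δ : r at i < δ i) where

    successor : State
    successor = state (updateAt (coords r) i suc) λ j → bound j
      where
      bound : ∀ j → lookup (updateAt (coords r) i suc) j ≤ δ j
      bound j with j Fin.≟ i
      ... | yes refl = ≤-trans (≤-reflexive (lookup∘updateAt i (coords r))) r<δ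
      ... | no  j≢i  = ≤-trans (≤-reflexive (lookup∘updateAt′ j i j≢i (coords r))) (at≤δ r j)

    successor-at : successor at i ≡ suc (r at i)
    successor-at = lookup∘updateAt i (coords r)

    successor-at′ : ∀ {j} → j ≢ i → successor at j ≡ r at j
    successor-at′ {j} j≢i = lookup∘updateAt′ j i j≢i (coords r)

    successor-e : successor -e i ≡ r
    successor-e = State-ext λ j → cong (λ x → lookup x j) (trans (updateAt-updateAt i (coords r)) (updateAt-id i (coords r)))

  -- The recurrence

  D-pos : ∀ r → 0 < D r
  D-pos r = ∏-pos λ i → m≤n+m 1 (exponent r i)

  predecessor⇒≢origin : ∀ r i → 0 < r at i → r ≢ origin
  predecessor⇒≢origin r i pos refl = <⇒≢ pos (sym (origin-at i))

  -- Any single predecessor is one of the candidates in the maximum.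
  F-lower : ∀ r i → N r ≤ X → Predecessor r i → D r ⊓ F (r -e i) ≤ F r
  F-lower r i N≤X pre = begin
    D r ⊓ F (r -e i)          ≤⟨ ⊓-monoʳ-≤ (D r) (v≤max⁺ 0 _ (inj₂ (lose
                                   (∈-map⁺ (λ i → F (r -e i)) (∈-filter⁺ (predecessor? r) (∈-allFin i) pre)) ≤-refl))) ⟩
    D r ⊓ bestPredecessor F r ≡⟨ F-step r N≤X (predecessor⇒≢origin r i (proj₁ pre)) ⟨
    F r                       ∎
    where open ≤-Reasoning

  F-cases : ∀ r → F r ≡ 0 ⊎ (r ≡ origin × F r ≡ D r) ⊎ F r ≡ D r ⊓ bestPredecessor F r
  F-cases r = cases (N r ≤? X) (≡-dec _≟_ (coords r) (coords origin))
    where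
    cases : Dec (N r ≤ X) → Dec (coords r ≡ coords origin) →
            F r ≡ 0 ⊎ (r ≡ origin × F r ≡ D r) ⊎ F r ≡ D r ⊓ bestPredecessor F r
    cases (no  N≰X) _         = inj₁ (F-inadmissible r N≰X)
    cases (yes N≤X) (yes r≡0) with refl ← r≡0 = inj₂ (inj₁ (refl , F-origin N≤X))
    cases (yes N≤X) (no  r≢0) = inj₂ (inj₂ (F-step r N≤X λ { refl → r≢0 refl }))

  F≤D : ∀ r → F r ≤ D r
  F≤D r with F-cases r
  ... | inj₁ F≡0              = ≤-trans (≤-reflexive F≡0) z≤n
  ... | inj₂ (inj₁ (_ , F≡D)) = ≤-reflexive F≡D
  ... | inj₂ (inj₂ F≡⊓)       = ≤-trans (≤-reflexive F≡⊓) (m⊓n≤m _ _)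

  -- Positivity excludes both inadmissibility and the default value 0 of `max`, so away from the
  -- origin the maximum is attained at an actual predecessor.
  F-attained : ∀ r → 0 < F r → r ≡ origin ⊎ ∃[ i ] Predecessor r i × F r ≡ D r ⊓ F (r -e i)
  F-attained r F>0 with F-cases r
  ... | inj₁ F≡0              = contradiction F>0 (<-irrefl (sym F≡0))
  ... | inj₂ (inj₁ (r≡0 , _)) = inj₁ r≡0
  ... | inj₂ (inj₂ F≡⊓) with argmax-sel (λ x → x) 0 (map (λ i → F (r -e i)) (filter (predecessor? r) (allFin k)))
  ...   | inj₁ best≡0 = contradiction F>0 (<-irrefl (sym (trans F≡⊓ (trans (cong (D r ⊓_) best≡0) (⊓-zeroʳ (D r))))))
  ...   | inj₂ best∈ with ∈-map⁻ (λ i → F (r -e i)) best∈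
  ...     | i , i∈ , best≡ = inj₂ (i , proj₂ (∈-filter⁻ (predecessor? r) {xs = allFin k} i∈) , trans F≡⊓ (cong (D r ⊓_) best≡))

  -- Well-founded because lowering a positive coordinate lowers the coordinate sum, which `s` bounds
  -- strictly from above.
  State-induction : (P : State → Set) → (∀ r → (∀ i → 0 < r at i → P (r -e i)) → P r) → ∀ r → P r
  State-induction P step r = go (suc (sum (coords r))) r ≤-refl
    where
    go : ∀ s r → sum (coords r) < s → P r
    go (suc s) r (s≤s le) = step r λ i pos → go s (r -e i) (<-≤-trans (sum-updateAt-pred (coords r) i pos) le)

-- Counting states

-- Induction on `k`: the first coordinate takes `δ zero + 1` values independently of the others,
-- which form a state of the remaining family.
State↔ : ∀ {k} (p a b : Fin k → ℕ) X → Recursion.State p a b X ↔ Fin (∏ λ i → Recursion.δ p a b X i + 1)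
State↔ {zero}  p a b X = mk↔ₛ′ (λ _ → zero) (λ _ → Recursion.origin p a b X) (λ { zero → refl }) λ { (Recursion.state [] _) → refl }
State↔ {suc k} p a b X = ↔-trans uncons (↔-trans (↔-refl ×-cong State↔ (p ∘ suc) (a ∘ suc) (b ∘ suc) X) (↔-sym Fin.*↔×))
  where
  open Recursion p a b X
  module Tail = Recursion (p ∘ suc) (a ∘ suc) (b ∘ suc) X

  uncons : State ↔ (Fin (δ zero + 1) × Tail.State)
  uncons = mk↔ₛ′ to from to∘from from∘to
    where
    to : State → Fin (δ zero + 1) × Tail.State
    -- The irrelevant bound is enough, as `fromℕ<` uses its proof only irrelevantly.
    to (state (x ∷ xs) x≤δ) = fromℕ< {x} (≤-trans (s≤s (x≤δ zero)) (≤-reflexive (+-comm 1 (δ zero)))) , Tail.state xs (λ i → x≤δ (suc i))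

    from : Fin (δ zero + 1) × Tail.State → State
    from (x , Tail.state xs xs≤δ) = state (toℕ x ∷ xs) λ where
      zero    → s≤s⁻¹ (≤-trans (Fin.toℕ<n x) (≤-reflexive (+-comm (δ zero) 1)))
      (suc i) → xs≤δ i

    to∘from : ∀ y → to (from y) ≡ y
    to∘from (x , Tail.state xs _) = cong (_, _) (Fin.fromℕ<-toℕ x _)

    from∘to : ∀ r → from (to r) ≡ r
    from∘to r@(state (x ∷ xs) _) = States.State-ext p a b X {from (to r)} {r} λ where
      zero    → Fin.toℕ-fromℕ< _
      (suc i) → refl

-- Geodesics as lattice paths of states

module Optimality {k : ℕ} (p a b : Fin k → ℕ) (X : ℕ) (pr : ∀ i → Prime (p i)) (inj : Injective _≡_ _≡_ p) where

  open Recursion p a b X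
  open States p a b X

  N-pos : ∀ r → 0 < N r
  N-pos r = ∏-pos (primePower-pos pr (exponent r))

  d-N : ∀ r → d (N r) ≡ D r
  d-N r = d-∏ pr inj (exponent r)

  ν-N : ∀ r i → ν (p i) (N r) ≡ exponent r i
  ν-N r = ν-∏ pr inj (exponent r)

  -- At most the coordinate belonging to `q` matters; a prime outside the family has exponent 0 in
  -- both numbers, and the hypothesis is then vacuous.
  ν-N-cong : ∀ r s {q} → Prime q → (∀ i → p i ≡ q → r at i ≡ s at i) → ν q (N r) ≡ ν q (N s)
  ν-N-cong r s {q} pr-q eq with Fin.any? (λ i → p i ≟ q)
  ... | yes (i , refl) = trans (ν-N r i) (trans (exponent-cong r s i (eq i refl)) (sym (ν-N s i)))
  ... | no  ∄i         = trans (ν-∏-other pr pr-q (λ i p≡q → ∄i (i , p≡q)) (exponent r))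
                          (sym (ν-∏-other pr pr-q (λ i p≡q → ∄i (i , p≡q)) (exponent s)))

  ν-N-top : ∀ i → ν (p i) (N top) ≡ b i
  ν-N-top i = trans (ν-N top i) (exponent-full top i (top-at i))

  N-mono : ∀ r s → (∀ i → exponent r i ≤ exponent s i) → N r ≤ N s
  N-mono r s le = ∏-mono-≤ λ i → ^-monoʳ-≤ (p i) {{prime⇒nonZero (pr i)}} (le i)

  step-toward : ∀ r i → 0 < r at i → Step (N top) (N (r -e i)) (N r)
  step-toward r i pos = record
    { source-positive = N-pos (r -e i)
    ; result-positive = N-pos r
    ; prime           = p i
    ; isPrime         = pr i
    ; towards-target  = subst (λ t → Toward t (ν (p i) (N (r -e i))) (ν (p i) (N r))) (sym (ν-N-top i))
                          (subst₂ (Toward (b i)) (sym (ν-N (r -e i) i)) (sym (ν-N r i))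
                            (exponent-step (r -e i) r i (suc-pred-at r i pos)))
    ; others-fixed    = λ q pr-q q≢p → ν-N-cong r (r -e i) pr-q λ j pj≡q →
                          sym (-e-at′ r λ j≡i → q≢p (trans (sym pj≡q) (cong p j≡i)))
    }

  step-successor : ∀ {r z} → Step (N top) (N r) z →
                   ∃[ i ] ∃[ s ] 0 < s at i × s -e i ≡ r × z ≡ N s
  step-successor {r} {z} st with Fin.any? (λ i → p i ≟ Step.prime st)
  -- A prime outside the family has exponent 0 in both the source and the target, which leaves no
  -- direction to move in.
  ... | no ∄i = contradiction (Step.towards-target st) (subst₂ (λ t e → ¬ Toward t e _) (sym (ν≡0 top)) (sym (ν≡0 r)) stuck)
    where
    ν≡0 : ∀ s → ν (Step.prime st) (N s) ≡ 0
    ν≡0 s = ν-∏-other pr (Step.isPrime st) (λ i p≡q → ∄i (i , p≡q)) (exponent s)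
    stuck : ∀ {e} → ¬ Toward 0 0 e
    stuck (inj₁ (() , _))
    stuck (inj₂ (() , _))
  ... | yes (i , refl) = i , s , subst (0 <_) (sym s-at) z<s , successor-e r i r<δ ,
        ν-ext (Step.result-positive st) (N-pos s) ν≡
    where
    toward : Toward (b i) (exponent r i) (ν (p i) z)
    toward = subst₂ (λ t e → Toward t e (ν (p i) z)) (ν-N-top i) (ν-N r i) (Step.towards-target st)
    r<δ : r at i < δ i
    -- At a full coordinate the exponent already equals its target, so no step could change it.
    r<δ = ≤∧≢⇒< (at≤δ r i) λ full → Toward⇒≢ toward (exponent-full r i full)
    s : State
    s = successor r i r<δ
    s-at : s at i ≡ suc (r at i)
    s-at = successor-at r i r<δ
    ν≡ : ∀ q → Prime q → ν q z ≡ ν q (N s)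
    ν≡ q pr-q with q ≟ p i
    ... | yes refl = trans (Toward-unique toward (exponent-step r s i s-at)) (sym (ν-N s i))
    ... | no  q≢p  = trans (Step.others-fixed st q pr-q q≢p) (ν-N-cong r s pr-q λ j pj≡q →
                       sym (successor-at′ r i r<δ λ j≡i → q≢p (trans (sym pj≡q) (cong p j≡i))))

  -- The upper bound

  N-injective : ∀ r s → N r ≡ N s → r ≡ s
  N-injective r s eq = State-ext λ i → exponent-injective r s i
    (trans (sym (ν-N r i)) (trans (cong (ν (p i)) eq) (ν-N s i)))

  -- By `F-lower`, passing to `s` costs at most a minimum with `D s`. But `D s` is `d z′`, and `z′`
  -- is the first vertex of `γ`, so `bottleneck γ` already accounts for it.
  F⊓bottleneck-step : ∀ {z z′} (st : Step (N top) z z′) (γ : Geodesic z′ (N top)) s i → 0 < s at i →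
                      z ≡ N (s -e i) → z′ ≡ N s → Admissible X (st ◅ γ) →
                      F (s -e i) ⊓ bottleneck (st ◅ γ) ≤ F s ⊓ bottleneck γ
  F⊓bottleneck-step {z} {z′} st γ s i pos z≡ z′≡ adm = ⊓-glb (≤-trans (⊓-glb ≤D (m⊓n≤m _ _)) lower) ≤bγ
    where
    lower : D s ⊓ F (s -e i) ≤ F s
    lower = F-lower s i (subst (_≤ X) z′≡ (admissible-source γ (admissible-◅⁻ st γ adm)))
      (pos , subst (_≤ X) z≡ (admissible-source (st ◅ γ) adm))
    ≤bγ : F (s -e i) ⊓ bottleneck (st ◅ γ) ≤ bottleneck γ
    ≤bγ = ≤-trans (m⊓n≤n (F (s -e i)) _) (≤-trans (≤-reflexive (bottleneck-◅ st γ)) (m⊓n≤n (d z) _))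
    ≤D : F (s -e i) ⊓ bottleneck (st ◅ γ) ≤ D s
    ≤D = ≤-trans ≤bγ (≤-trans (bottleneck≤source γ) (≤-reflexive (trans (cong d z′≡) (d-N s))))

  -- Induction along the geodesic, ending where `r` is `top`. The source is a variable `z` with an
  -- equation so that `γ` can be matched on.
  F⊓bottleneck≤F-top : ∀ {z} (γ : Geodesic z (N top)) r → z ≡ N r → Admissible X γ → F r ⊓ bottleneck γ ≤ F top
  F⊓bottleneck≤F-top ε r z≡ adm =
    ≤-trans (m⊓n≤m (F r) _) (≤-reflexive (cong F (sym (N-injective top r z≡))))
  F⊓bottleneck≤F-top {z} (st ◅ γ) r z≡ adm =
    let i , s , pos , s-e≡r , z′≡ = step-successor (subst (λ z → Step (N top) z _) z≡ st) in
    ≤-trans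
      (subst (λ r → F r ⊓ bottleneck (st ◅ γ) ≤ F s ⊓ bottleneck γ) s-e≡r
        (F⊓bottleneck-step st γ s i pos (trans z≡ (cong N (sym s-e≡r))) z′≡ adm))
      (F⊓bottleneck≤F-top γ s z′≡ (admissible-◅⁻ st γ adm))

  -- A geodesic attaining the recurrence

  Extension : State → Set
  Extension r = 0 < F r → (γ : Geodesic (N r) (N top)) → Admissible X γ →
                ∃[ γ′ ] Admissible {N origin} {N top} X γ′ × bottleneck γ′ ≡ F r ⊓ bottleneck γ

  -- The geodesic `γ` accumulates the part already built. Each round prepends the predecessor chosen
  -- by `F-attained` and leaves the minimum of `F` and the bottleneck unchanged.
  extend : N origin ≤ X → ∀ r → Extension r
  extend m≤X = State-induction Extension step
    where
    step : ∀ r → (∀ i → 0 < r at i → Extension (r -e i)) → Extension r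
    step r rec F>0 γ adm with F-attained r F>0
    -- The path is complete; `F origin` is `d` of its first vertex, so it does not lower the
    -- minimum.
    ... | inj₁ refl = γ , adm , sym (m≥n⇒m⊓n≡n
          (≤-trans (bottleneck≤source γ) (≤-reflexive (trans (d-N origin) (sym (F-origin m≤X))))))
    ... | inj₂ (i , (pos , N≤X) , F≡) =
      let γ′ , adm′ , eq = rec i pos (<-≤-trans F>0 (≤-trans (≤-reflexive F≡) (m⊓n≤n (D r) _)))
                             (st ◅ γ) (admissible-◅⁺ st γ N≤X adm)
      in γ′ , adm′ , trans eq same
      where
      open ≡-Reasoning
      st = step-toward r i pos
      F′ = F (r -e i)
      -- Two absorptions: `F′` is at most `d` of the new vertex, and `bottleneck γ` is at most
      -- `D r`.
      same : F′ ⊓ bottleneck (st ◅ γ) ≡ F r ⊓ bottleneck γ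
      same = begin
        F′ ⊓ bottleneck (st ◅ γ)                ≡⟨ cong (F′ ⊓_) (bottleneck-◅ st γ) ⟩
        F′ ⊓ (d (N (r -e i)) ⊓ bottleneck γ)    ≡⟨ ⊓-assoc F′ _ _ ⟨
        F′ ⊓ d (N (r -e i)) ⊓ bottleneck γ      ≡⟨ cong (_⊓ bottleneck γ) (m≤n⇒m⊓n≡m (≤-trans (F≤D (r -e i)) (≤-reflexive (sym (d-N (r -e i)))))) ⟩
        F′ ⊓ bottleneck γ                       ≡⟨ cong (F′ ⊓_) (m≥n⇒m⊓n≡n (≤-trans (bottleneck≤source γ) (≤-reflexive (d-N r)))) ⟨
        F′ ⊓ (D r ⊓ bottleneck γ)               ≡⟨ ⊓-assoc F′ (D r) _ ⟨
        F′ ⊓ D r ⊓ bottleneck γ                 ≡⟨ cong (_⊓ bottleneck γ) (trans (⊓-comm F′ (D r)) (sym F≡)) ⟩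
        F r ⊓ bottleneck γ                      ∎

  -- Positivity at the top state, and optimality

  module _ (m≤X : N origin ≤ X) (n≤X : N top ≤ X) where

    F-pos-step : ∀ r i → N r ≤ X → Predecessor r i → 0 < F (r -e i) → 0 < F r
    F-pos-step r i N≤X pre F>0 = <-≤-trans (⊓-glb (D-pos r) F>0) (F-lower r i N≤X pre)

    -- The states on the first (decreasing) and on the second (increasing) part
    -- of the path that performs all decreasing steps first.
    Descending : State → Set
    Descending r = ∀ i → a i ≤ b i → r at i ≡ 0

    Descended : State → Set
    Descended r = ∀ i → b i ≤ a i → r at i ≡ δ i

    -- Exponents have only dropped so far, so `N r` is at most `N origin`.
    descending-admissible : ∀ r → Descending r → N r ≤ X
    descending-admissible r desc = ≤-trans (N-mono r origin le) m≤X
      where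
      le : ∀ i → exponent r i ≤ exponent origin i
      le i with ≤-total (a i) (b i)
      ... | inj₁ a≤b = ≤-reflexive (exponent-cong r origin i (trans (desc i a≤b) (sym (origin-at i))))
      ... | inj₂ b≤a = ≤-trans (≤-trans (m≤m+n _ _) (≤-reflexive (exponent-down-at r i b≤a))) (≤-reflexive (sym (exponent-origin i)))

    -- Only increasing steps remain, so `N r` is at most `N top`.
    descended-admissible : ∀ r → Descended r → N r ≤ X
    descended-admissible r desc = ≤-trans (N-mono r top le) n≤X
      where
      le : ∀ i → exponent r i ≤ exponent top i
      le i with ≤-total (a i) (b i)
      ... | inj₁ a≤b = begin
        exponent r i      ≡⟨ exponent-up-at r i a≤b ⟩
        a i + r at i      ≤⟨ +-monoʳ-≤ (a i) (at≤δ r i) ⟩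
        a i + δ i         ≡⟨ cong (a i +_) (top-at i) ⟨
        a i + top at i    ≡⟨ exponent-up-at top i a≤b ⟨
        exponent top i    ∎
        where open ≤-Reasoning
      ... | inj₂ b≤a = ≤-reflexive (exponent-cong r top i (trans (desc i b≤a) (sym (top-at i))))

    F-pos-descending : ∀ r → Descending r → 0 < F r
    F-pos-descending = State-induction (λ r → Descending r → 0 < F r) step
      where
      step : ∀ r → (∀ i → 0 < r at i → Descending (r -e i) → 0 < F (r -e i)) → Descending r → 0 < F r
      step r rec desc with Fin.any? (λ i → 0 <? r at i)
      ... | yes (i , pos) = F-pos-step r i (descending-admissible r desc)
              (pos , descending-admissible (r -e i) desc′) (rec i pos desc′)
        where
        desc′ : Descending (r -e i)
        desc′ j a≤b = n≤0⇒n≡0 (≤-trans (-e-≤ r i j) (≤-reflexive (desc j a≤b)))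
      ... | no  ∄pos with refl ← State-ext {r} {origin} (λ i → trans (n≤0⇒n≡0 (≮⇒≥ λ pos → ∄pos (i , pos))) (sym (origin-at i))) =
              subst (0 <_) (sym (F-origin m≤X)) (D-pos origin)

    F-pos-descended : ∀ r → Descended r → 0 < F r
    F-pos-descended = State-induction (λ r → Descended r → 0 < F r) step
      where
      step : ∀ r → (∀ i → 0 < r at i → Descended (r -e i) → 0 < F (r -e i)) → Descended r → 0 < F r
      -- Walking backwards, only strictly increasing coordinates are lowered, which keeps the state
      -- `Descended`.
      step r rec desc with Fin.any? (λ i → (0 <? r at i) ×-dec (a i <? b i))
      ... | yes (i , pos , a<b) = F-pos-step r i (descended-admissible r desc)
              (pos , descended-admissible (r -e i) desc′) (rec i pos desc′)
        where
        desc′ : Descended (r -e i)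
        desc′ j b≤a = trans (-e-at′ r λ { refl → <⇒≱ a<b b≤a }) (desc j b≤a)
      -- All increasing steps are undone. A positive coordinate with `a i ≤ b i` would need
      -- `a i ≡ b i`, where `δ i` is 0; hence `r` is `Descending`.
      ... | no  ∄up = F-pos-descending r λ i a≤b → n≤0⇒n≡0 (≮⇒≥ λ pos →
              let b≤a = ≮⇒≥ λ a<b → ∄up (i , pos , a<b)
              in <⇒≱ pos (≤-trans (at≤δ r i) (≤-reflexive (m≡n⇒∣m-n∣≡0 (≤-antisym b≤a a≤b)))))

    optimal : 𝒢[ X , N origin , N top ]≡ F top
    optimal = record
      -- The extension starts from the trivial geodesic at `top`, whose bottleneck `D top` is at
      -- least `F top`.
      { attained   = let γ , adm , eq = extend m≤X top (F-pos-descended top λ i _ → top-at i) ε (n≤X ∷ [])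
                     in γ , adm , trans eq (m≤n⇒m⊓n≡m (≤-trans (F≤D top) (≤-reflexive (sym (d-N top)))))
      -- At the origin `F` equals `d` of the source, so the invariant starts at no less than
      -- `bottleneck γ`.
      ; upperBound = λ γ adm → ≤-trans
          (⊓-glb (≤-trans (bottleneck≤source γ) (≤-reflexive (trans (d-N origin) (sym (F-origin m≤X))))) ≤-refl)
          (F⊓bottleneck≤F-top γ origin refl adm)
      }

theorem2p3 : (m n : ℕ) → 1 ≤ m → 1 ≤ n →
    (k : ℕ) (p : Fin k → ℕ) →
    (∀ i → Prime (p i)) →
    Injective _≡_ _≡_ p →
    (∀ q → Prime q → q ∣ m * n → ∃[ i ] p i ≡ q) →
    (a b : Fin k → ℕ) →
    m ≡ ∏ (λ i → p i ^ a i) →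
    n ≡ ∏ (λ i → p i ^ b i) →
    (X : ℕ) → m ⊔ n ≤ X →
    let open Recursion p a b X in
    (𝒢[ X , m , n ]≡ F top) × (State ↔ Fin (∏ (λ i → δ i + 1)))
theorem2p3 m n _ _ k p pr inj _ a b m≡ n≡ X m⊔n≤X =
  -- The given factorizations identify `m` and `n` with the numbers of the states `origin` and
  -- `top`.
  subst₂ (λ m n → 𝒢[ X , m , n ]≡ F top) (sym m≡N) (sym n≡N)
    (optimal (subst (_≤ X) m≡N (m⊔n≤o⇒m≤o m n m⊔n≤X)) (subst (_≤ X) n≡N (m⊔n≤o⇒n≤o m n m⊔n≤X))) ,
  State↔ p a b X
  where
  open Recursion p a b X
  open States p a b X
  open Optimality p a b X pr inj
  m≡N : m ≡ N origin
  m≡N = trans m≡ (∏-cong λ i → cong (p i ^_) (sym (exponent-origin i)))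
  n≡N : n ≡ N top
  n≡N = trans n≡ (∏-cong λ i → cong (p i ^_) (sym (exponent-full top i (top-at i))))
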